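{- Let $\mathbf A$ be a conic idempotent residuated lattice. Then $\mathbf A$ is conjunctive if and only if all of its blocks are lattices; equivalently, if and only if all of its positive blocks are lattices.
   Context: A residuated lattice is an algebra $(A,\wedge,\vee,\cdot,\backslash,/,1)$ such that $(A,\wedge,\vee)$ is a lattice, $(A,\cdot,1)$ is a monoid, and $y\le x\backslash z \iff x\cdot y\le z\iff x\le z/y$ for all $x,y,z$. It is idempotent if it satisfies $x\cdot x=x$, and conic if every $a\in A$ satisfies $a\le 1$ or $1\le a$. Define $x^r:=x\backslash 1$, $x^\ell:=1/x$, $\gamma(x):=x^{\ell r}\wedge x^{r\ell}$ (superscripts are applied from left to right). $\mathbf A$ is conjunctive if it satisfies $\gamma(x\wedge y)=\gamma(x)\wedge\gamma(y)$. Let $A^i:=\{x^\ell:x\in A\}\cup\{x^r:x\in A\}$. The blocks of $\mathbf A$ are the sets $\gamma^{ -1}(a)$ for $a\in A^i$, with the order inherited from $\mathbf A$; the block $\gamma^{ -1}(a)$ is positive if $a\ge 1$. (Each block is a join-subsemilattice of $\mathbf A$ that becomes a lattice after adjoining a new bottom element.) -}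

module Defs where

open import Algebra.Core using (Op₁; Op₂)
open import Algebra.Definitions using (Idempotent)
open import Algebra.Structures using (IsMonoid)
open import Data.Product using (Σ; ∃-syntax; ∃₂; proj₁)
open import Data.Sum using (_⊎_)
open import Function.Bundles using (_⇔_)
open import Level using (suc; _⊔_)
open import Relation.Binary.Bundles using (Poset)
open import Relation.Binary.Core using (Rel)
open import Relation.Binary.Lattice using (Lattice; IsLattice)
import Relation.Binary.Construct.On as On

record ResiduatedLattice c ℓ₁ ℓ₂ : Set (suc (c ⊔ ℓ₁ ⊔ ℓ₂)) where
  infix  4 _≈_ _≤_
  infixr 6 _∨_
  infixr 7 _∧_
  infixl 8 _∙_
  infix  8 _\\_ _//_
  field
    Carrier   : Set c
    _≈_       : Rel Carrier ℓ₁
    _≤_       : Rel Carrier ℓ₂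
    _∨_       : Op₂ Carrier
    _∧_       : Op₂ Carrier
    _∙_       : Op₂ Carrier
    _\\_      : Op₂ Carrier
    _//_      : Op₂ Carrier
    1#        : Carrier
    isLattice : IsLattice _≈_ _≤_ _∨_ _∧_
    isMonoid  : IsMonoid _≈_ _∙_ 1#
    \\-resid  : ∀ x y z → y ≤ x \\ z ⇔ x ∙ y ≤ z
    //-resid  : ∀ x y z → x ∙ y ≤ z ⇔ x ≤ z // y

  lattice : Lattice c ℓ₁ ℓ₂
  lattice = record { isLattice = isLattice }

  open Lattice lattice public using (poset)

IsLatticeOrdered : ∀ {c ℓ₁ ℓ₂} → Poset c ℓ₁ ℓ₂ → Set (c ⊔ ℓ₁ ⊔ ℓ₂)
IsLatticeOrdered P = ∃₂ λ join meet → IsLattice _≈_ _≤_ join meet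
  where open Poset P

module _ {c ℓ₁ ℓ₂} (A : ResiduatedLattice c ℓ₁ ℓ₂) where
  open ResiduatedLattice A

  IsIdempotent : Set (c ⊔ ℓ₁)
  IsIdempotent = Idempotent _≈_ _∙_

  IsConic : Set (c ⊔ ℓ₂)
  IsConic = ∀ a → a ≤ 1# ⊎ 1# ≤ a

  infixl 9 _ʳ _ˡ

  _ʳ : Op₁ Carrier
  x ʳ = x \\ 1#

  _ˡ : Op₁ Carrier
  x ˡ = 1# // x

  γ : Op₁ Carrier
  γ x = x ˡ ʳ ∧ x ʳ ˡ

  IsConjunctive : Set (c ⊔ ℓ₁)
  IsConjunctive = ∀ x y → γ (x ∧ y) ≈ γ x ∧ γ y

  -- Membership in Aⁱ.
  IsInverse : Carrier → Set (c ⊔ ℓ₁)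
  IsInverse a = (∃[ x ] a ≈ x ˡ) ⊎ (∃[ x ] a ≈ x ʳ)

  -- The fibre γ⁻¹(a); equality and order compare only the underlying
  -- elements, not the proofs of membership.
  Block : Carrier → Poset (c ⊔ ℓ₁) ℓ₁ ℓ₂
  Block a = On.poset {B = Σ Carrier (λ x → γ x ≈ a)} poset proj₁

  -- The joins and meets are those of the block's own order; they are not
  -- required to agree with the operations of A.
  BlocksAreLattices : Set (c ⊔ ℓ₁ ⊔ ℓ₂)
  BlocksAreLattices = ∀ a → IsInverse a → IsLatticeOrdered (Block a)

  PositiveBlocksAreLattices : Set (c ⊔ ℓ₁ ⊔ ℓ₂)
  PositiveBlocksAreLattices =
    ∀ a → IsInverse a → 1# ≤ a → IsLatticeOrdered (Block a)

{-# OPTIONS --safe #-}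

-- Because the product of two elements is comparable to 1, idempotence makes
-- every inverse c prime for multiplication (x ∙ y ≤ c implies x ≤ c or y ≤ c)
-- and comparable to every element of A; also γ x is the least inverse above x.
-- If γ x ≤ y then x ∧ y is x, and likewise with x and y exchanged, so γ can
-- only fail to preserve x ∧ y when x and y share a block.  In a block below 1
-- it cannot fail, since x ∙ y ≤ x ∧ y and γ (x ∧ y) is prime.  In a positive
-- block, a common lower bound of x and y inside the block is exactly what is
-- needed.

module Submission where

open import Defs
open import Algebra.Structures using (IsMonoid)
open import Data.Product using (_×_; _,_; proj₂)
open import Data.Sum using (_⊎_; inj₁; inj₂; [_,_]′)
import Data.Sum as Sum
open import Function.Base using (_∘_; flip)
open import Function.Bundles using (_⇔_; mk⇔; module Equivalence)
open import Relation.Binary.Bundles using (module Poset)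
open import Relation.Binary.Lattice using (Lattice; IsLattice)
import Algebra.Construct.Flip.Op as Op
import Relation.Binary.Lattice.Properties.MeetSemilattice as MeetProperties

-- Reversing the product exchanges the two residuals, so each fact about right inverses also yields
-- its mirror image for left inverses.
opposite : ∀ {c ℓ₁ ℓ₂} → ResiduatedLattice c ℓ₁ ℓ₂ → ResiduatedLattice c ℓ₁ ℓ₂
opposite A = record
  { Carrier   = Carrier
  ; _≈_       = _≈_
  ; _≤_       = _≤_
  ; _∨_       = _∨_
  ; _∧_       = _∧_
  ; _∙_       = flip _∙_
  ; _\\_      = flip _//_
  ; _//_      = flip _\\_
  ; 1#        = 1#
  ; isLattice = isLattice
  ; isMonoid  = Op.isMonoid isMonoid
  ; \\-resid  = λ x y z → mk⇔ (from (//-resid y x z)) (to (//-resid y x z))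
  ; //-resid  = λ x y z → mk⇔ (from (\\-resid y x z)) (to (\\-resid y x z))
  }
  where
  open ResiduatedLattice A
  open Equivalence

module ResiduationProperties {c ℓ₁ ℓ₂} (A : ResiduatedLattice c ℓ₁ ℓ₂) where
  open ResiduatedLattice A
  open Lattice lattice public
    using (refl; reflexive; trans; antisym; x≤x∨y; y≤x∨y; x∧y≤x; x∧y≤y;
           ∧-greatest; ∨-least; ≤-respʳ-≈; module Eq)
  open IsMonoid isMonoid public using (assoc; identityˡ; identityʳ)
  open Equivalence

  ∙-monoˡ : ∀ {x y} z → x ≤ y → x ∙ z ≤ y ∙ z
  ∙-monoˡ z x≤y = from (//-resid _ _ _) (trans x≤y (to (//-resid _ _ _) refl))

  ∙-monoʳ : ∀ {x y} z → x ≤ y → z ∙ x ≤ z ∙ y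
  ∙-monoʳ z x≤y = to (\\-resid _ _ _) (trans x≤y (from (\\-resid _ _ _) refl))

  x≤1⇒x∙y≤y : ∀ {x} y → x ≤ 1# → x ∙ y ≤ y
  x≤1⇒x∙y≤y y x≤1 = trans (∙-monoˡ y x≤1) (reflexive (identityˡ y))

  y≤1⇒x∙y≤x : ∀ x {y} → y ≤ 1# → x ∙ y ≤ x
  y≤1⇒x∙y≤x x y≤1 = trans (∙-monoʳ x y≤1) (reflexive (identityʳ x))

  1≤x⇒y≤x∙y : ∀ {x} y → 1# ≤ x → y ≤ x ∙ y
  1≤x⇒y≤x∙y y 1≤x = trans (reflexive (Eq.sym (identityˡ y))) (∙-monoˡ y 1≤x)

  1≤y⇒x≤x∙y : ∀ x {y} → 1# ≤ y → x ≤ x ∙ y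
  1≤y⇒x≤x∙y x 1≤y = trans (reflexive (Eq.sym (identityʳ x))) (∙-monoʳ x 1≤y)

  ∙-∨-least : ∀ {x y z w} → x ∙ y ≤ w → x ∙ z ≤ w → x ∙ (y ∨ z) ≤ w
  ∙-∨-least xy≤w xz≤w =
    to (\\-resid _ _ _) (∨-least (from (\\-resid _ _ _) xy≤w) (from (\\-resid _ _ _) xz≤w))

  ∙-assoc-≤ : ∀ {x y z w} → (x ∙ y) ∙ z ≤ w → x ∙ (y ∙ z) ≤ w
  ∙-assoc-≤ = trans (reflexive (Eq.sym (assoc _ _ _)))

  ∙-assoc-≤⁻ : ∀ {x y z w} → x ∙ (y ∙ z) ≤ w → (x ∙ y) ∙ z ≤ w
  ∙-assoc-≤⁻ = trans (reflexive (assoc _ _ _))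

  x∙y≤1⇒y≤xʳ : ∀ {x y} → x ∙ y ≤ 1# → y ≤ (A ʳ) x
  x∙y≤1⇒y≤xʳ = from (\\-resid _ _ _)

  y≤xʳ⇒x∙y≤1 : ∀ {x y} → y ≤ (A ʳ) x → x ∙ y ≤ 1#
  y≤xʳ⇒x∙y≤1 = to (\\-resid _ _ _)

  x∙y≤1⇒x≤yˡ : ∀ {x y} → x ∙ y ≤ 1# → x ≤ (A ˡ) y
  x∙y≤1⇒x≤yˡ = to (//-resid _ _ _)

  x≤xˡʳ : ∀ x → x ≤ (A ʳ) ((A ˡ) x)
  x≤xˡʳ x = x∙y≤1⇒y≤xʳ (from (//-resid _ _ _) refl)

  -- `ˡ` and `ʳ` form an antitone Galois connection; with `x≤xˡʳ` this makes `ˡʳ` the closure onto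
  -- the right inverses.
  x≤zʳ⇒xˡʳ≤zʳ : ∀ {x z} → x ≤ (A ʳ) z → (A ʳ) ((A ˡ) x) ≤ (A ʳ) z
  x≤zʳ⇒xˡʳ≤zʳ x≤zʳ = x∙y≤1⇒y≤xʳ
    (trans (∙-monoˡ _ (x∙y≤1⇒x≤yˡ (y≤xʳ⇒x∙y≤1 x≤zʳ))) (y≤xʳ⇒x∙y≤1 refl))

module RightInverseProperties {c ℓ₁ ℓ₂} (A : ResiduatedLattice c ℓ₁ ℓ₂)
  (conic : IsConic A) (idem : IsIdempotent A) where
  open ResiduatedLattice A
  open ResiduationProperties A

  -- Idempotence duplicates a factor, `x ∙ y ≈ (x ∙ y) ∙ y`, and multiplying by an element below 1
  -- only shrinks.
  x∙y≤1⇒x∙y≤y : ∀ {x y} → x ∙ y ≤ 1# → x ∙ y ≤ y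
  x∙y≤1⇒x∙y≤y {x} {y} xy≤1 =
    trans (∙-monoʳ x (reflexive (Eq.sym (idem y)))) (∙-assoc-≤ (x≤1⇒x∙y≤y y xy≤1))

  1≤x∙y⇒x≤x∙y : ∀ {x y} → 1# ≤ x ∙ y → x ≤ x ∙ y
  1≤x∙y⇒x≤x∙y {x} {y} 1≤xy =
    trans (1≤y⇒x≤x∙y x 1≤xy) (∙-assoc-≤ (∙-monoˡ y (reflexive (idem x))))

  1≤x∙y⇒y≤x∙y : ∀ {x y} → 1# ≤ x ∙ y → y ≤ x ∙ y
  1≤x∙y⇒y≤x∙y {x} {y} 1≤xy =
    trans (1≤x⇒y≤x∙y y 1≤xy) (∙-assoc-≤⁻ (∙-monoʳ x (reflexive (idem y))))

  -- If `z ∙ x` is not below 1 it is above 1, so `z ≤ z ∙ x` and therefore `z ∙ y ≤ z ∙ x ∙ y ≤ 1`.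
  ʳ-prime : ∀ {x y} z → x ∙ y ≤ (A ʳ) z → x ≤ (A ʳ) z ⊎ y ≤ (A ʳ) z
  ʳ-prime {x} {y} z xy≤zʳ = Sum.map x∙y≤1⇒y≤xʳ
    (λ 1≤zx → x∙y≤1⇒y≤xʳ (trans (∙-monoˡ y (1≤x∙y⇒x≤x∙y 1≤zx))
                                 (∙-assoc-≤⁻ (y≤xʳ⇒x∙y≤1 xy≤zʳ))))
    (conic (z ∙ x))

  ʳ-comparable : ∀ z y → y ≤ (A ʳ) z ⊎ (A ʳ) z ≤ y
  ʳ-comparable z y with conic z | conic y
  ... | inj₁ z≤1 | inj₁ y≤1 = inj₁ (x∙y≤1⇒y≤xʳ (trans (x≤1⇒x∙y≤y y z≤1) y≤1))
  ... | inj₂ 1≤z | inj₂ 1≤y =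
    inj₂ (trans (1≤x⇒y≤x∙y _ 1≤z) (trans (y≤xʳ⇒x∙y≤1 refl) 1≤y))
  -- Conicity is applied to `z ∙ (zʳ ∨ y)`, which involves both elements to be compared. If it is
  -- above 1, then it is above `zʳ ∨ y`, while `z ∙ zʳ ≤ 1 ≤ y` and `z ∙ y ≤ y` keep it below `y`.
  ... | inj₁ z≤1 | inj₂ 1≤y = Sum.map
    (λ z[zʳ∨y]≤1 → trans (y≤x∨y _ _) (x∙y≤1⇒y≤xʳ z[zʳ∨y]≤1))
    (λ 1≤z[zʳ∨y] → trans (x≤x∨y _ _) (trans (1≤x∙y⇒y≤x∙y 1≤z[zʳ∨y])
      (∙-∨-least (trans (y≤xʳ⇒x∙y≤1 refl) 1≤y) (x≤1⇒x∙y≤y y z≤1))))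
    (conic (z ∙ ((A ʳ) z ∨ y)))
  ... | inj₂ 1≤z | inj₁ y≤1 = Sum.map x∙y≤1⇒y≤xʳ zʳ≤y (conic (z ∙ y))
    where
    a : Carrier
    a = (A ʳ) z

    za≤1 : z ∙ a ≤ 1#
    za≤1 = y≤xʳ⇒x∙y≤1 refl

    a≤1 : a ≤ 1#
    a≤1 = trans (1≤x⇒y≤x∙y a 1≤z) za≤1

    z[ya]≤1 : z ∙ (y ∙ a) ≤ 1#
    z[ya]≤1 = trans (∙-monoʳ z (x≤1⇒x∙y≤y a y≤1)) za≤1

    -- a ≤ z ∙ a ≤ (z ∙ y) ∙ a ≈ z ∙ (y ∙ a) ≤ y ∙ a ≤ y
    zʳ≤y : 1# ≤ z ∙ y → a ≤ y
    zʳ≤y 1≤zy = trans (1≤x⇒y≤x∙y a 1≤z)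
      (trans (∙-monoˡ a (1≤x∙y⇒x≤x∙y 1≤zy))
      (∙-assoc-≤⁻ (trans (x∙y≤1⇒x∙y≤y z[ya]≤1) (y≤1⇒x∙y≤x y a≤1))))

module ConicIdempotent {c ℓ₁ ℓ₂} (A : ResiduatedLattice c ℓ₁ ℓ₂)
  (conic : IsConic A) (idem : IsIdempotent A) where
  open ResiduatedLattice A
  open ResiduationProperties A
  open MeetProperties (Lattice.meetSemilattice lattice) using (y≤x⇒x∧y≈y; ∧-comm)

  private
    module Aᵒᵖ  = ResiduationProperties (opposite A)
    module Inv  = RightInverseProperties A conic idem
    module Invᵒᵖ = RightInverseProperties (opposite A) conic idem

  inverse-comparable : ∀ {a} → IsInverse A a → ∀ y → y ≤ a ⊎ a ≤ y
  inverse-comparable (inj₁ (z , a≈zˡ)) y =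
    Sum.map (≤-respʳ-≈ (Eq.sym a≈zˡ)) (trans (reflexive a≈zˡ)) (Invᵒᵖ.ʳ-comparable z y)
  inverse-comparable (inj₂ (z , a≈zʳ)) y =
    Sum.map (≤-respʳ-≈ (Eq.sym a≈zʳ)) (trans (reflexive a≈zʳ)) (Inv.ʳ-comparable z y)

  inverse-prime : ∀ {a x y} → IsInverse A a → x ∙ y ≤ a → x ≤ a ⊎ y ≤ a
  -- The opposite algebra reads the product in reverse, so the alternatives come out exchanged.
  inverse-prime (inj₁ (z , a≈zˡ)) xy≤a = Sum.swap
    (Sum.map (≤-respʳ-≈ (Eq.sym a≈zˡ)) (≤-respʳ-≈ (Eq.sym a≈zˡ))
      (Invᵒᵖ.ʳ-prime z (≤-respʳ-≈ a≈zˡ xy≤a)))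
  inverse-prime (inj₂ (z , a≈zʳ)) xy≤a =
    Sum.map (≤-respʳ-≈ (Eq.sym a≈zʳ)) (≤-respʳ-≈ (Eq.sym a≈zʳ))
      (Inv.ʳ-prime z (≤-respʳ-≈ a≈zʳ xy≤a))

  -- Inverses are comparable to everything, so the meet defining `γ` is one of its two arguments.
  γ-isInverse : ∀ x → IsInverse A (γ A x)
  γ-isInverse x with Inv.ʳ-comparable ((A ˡ) x) ((A ˡ) ((A ʳ) x))
  ... | inj₁ xʳˡ≤xˡʳ = inj₁ ((A ʳ) x , y≤x⇒x∧y≈y xʳˡ≤xˡʳ)
  ... | inj₂ xˡʳ≤xʳˡ = inj₂ ((A ˡ) x , Eq.trans (∧-comm _ _) (y≤x⇒x∧y≈y xˡʳ≤xʳˡ))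

  x≤γx : ∀ x → x ≤ γ A x
  x≤γx x = ∧-greatest (x≤xˡʳ x) (Aᵒᵖ.x≤xˡʳ x)

  -- Whichever kind of inverse `a` is, the closure of `x` of that kind is below `a`, and `γ` is
  -- below both closures.
  γ-least : ∀ {x a} → IsInverse A a → x ≤ a → γ A x ≤ a
  γ-least (inj₁ (z , a≈zˡ)) x≤a =
    trans (x∧y≤y _ _) (≤-respʳ-≈ (Eq.sym a≈zˡ) (Aᵒᵖ.x≤zʳ⇒xˡʳ≤zʳ (≤-respʳ-≈ a≈zˡ x≤a)))
  γ-least (inj₂ (z , a≈zʳ)) x≤a =
    trans (x∧y≤x _ _) (≤-respʳ-≈ (Eq.sym a≈zʳ) (x≤zʳ⇒xˡʳ≤zʳ (≤-respʳ-≈ a≈zʳ x≤a)))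

  γ-≤ : ∀ {x y} → x ≤ γ A y → γ A x ≤ γ A y
  γ-≤ = γ-least (γ-isInverse _)

  γ-mono : ∀ {x y} → x ≤ y → γ A x ≤ γ A y
  γ-mono x≤y = γ-≤ (trans x≤y (x≤γx _))

  ∨-block : ∀ {a x y} → γ A x ≈ a → γ A y ≈ a → γ A (x ∨ y) ≈ a
  ∨-block {a} {x} {y} γx≈a γy≈a = antisym
    (trans (γ-≤ (∨-least (x≤γx x) (trans (x≤γx y) (reflexive (Eq.trans γy≈a (Eq.sym γx≈a))))))
      (reflexive γx≈a))
    (trans (reflexive (Eq.sym γx≈a)) (γ-mono (x≤x∨y x y)))

  -- Conjunctivity keeps `x ∧ y` inside the block, so the operations of `A` serve as those of the
  -- block.
  conjunctive⇒blocks : IsConjunctive A → BlocksAreLattices A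
  conjunctive⇒blocks conj a _ = join , meet , record
    { isPartialOrder = Poset.isPartialOrder (Block A a)
    ; supremum = λ (x , _) (y , _) → x≤x∨y x y , y≤x∨y x y , λ _ → ∨-least
    ; infimum  = λ (x , _) (y , _) → x∧y≤x x y , x∧y≤y x y , λ _ → ∧-greatest
    }
    where
    open Poset (Block A a) using () renaming (Carrier to B)

    join meet : B → B → B
    join (x , γx≈a) (y , γy≈a) = x ∨ y , ∨-block γx≈a γy≈a
    meet (x , γx≈a) (y , γy≈a) = x ∧ y , antisym
      (trans (γ-mono (x∧y≤x x y)) (reflexive γx≈a))
      (trans (∧-greatest (reflexive (Eq.sym γx≈a)) (reflexive (Eq.sym γy≈a)))
        (reflexive (Eq.sym (conj x y))))

  negative-block-∧ : ∀ {x y} → γ A x ≈ γ A y → γ A x ≤ 1# → γ A x ≤ γ A (x ∧ y)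
  negative-block-∧ {x} {y} γx≈γy γx≤1 =
    [ γ-≤ , trans (reflexive γx≈γy) ∘ γ-≤ ]′
      (inverse-prime (γ-isInverse (x ∧ y)) (trans xy≤x∧y (x≤γx (x ∧ y))))
    where
    x≤1 : x ≤ 1#
    x≤1 = trans (x≤γx x) γx≤1

    y≤1 : y ≤ 1#
    y≤1 = trans (x≤γx y) (trans (reflexive (Eq.sym γx≈γy)) γx≤1)

    xy≤x∧y : x ∙ y ≤ x ∧ y
    xy≤x∧y = ∧-greatest (y≤1⇒x∙y≤x x y≤1) (x≤1⇒x∙y≤y y x≤1)

  -- The meet taken in the block may differ from `x ∧ y`, but it lies below it and still has closure
  -- `γ x`, so monotonicity suffices.
  lattice-block-∧ : ∀ {x y} → IsLatticeOrdered (Block A (γ A x)) →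
                    γ A x ≈ γ A y → γ A x ≤ γ A (x ∧ y)
  lattice-block-∧ {x} {y} (_ , meet , isLat) γx≈γy =
    trans (reflexive (Eq.sym (proj₂ m)))
      (γ-mono (∧-greatest (IsLattice.x∧y≤x isLat x′ y′) (IsLattice.x∧y≤y isLat x′ y′)))
    where
    x′ = x , Eq.refl
    y′ = y , Eq.sym γx≈γy
    m = meet x′ y′

  positive-blocks⇒conjunctive : PositiveBlocksAreLattices A → IsConjunctive A
  positive-blocks⇒conjunctive blocks x y =
    antisym (∧-greatest (γ-mono (x∧y≤x x y)) (γ-mono (x∧y≤y x y))) γx∧γy≤
    where
    same-block : γ A x ≈ γ A y → γ A x ≤ γ A (x ∧ y)
    same-block γx≈γy =
      [ negative-block-∧ γx≈γy
      , (λ 1≤γx → lattice-block-∧ (blocks (γ A x) (γ-isInverse x) 1≤γx) γx≈γy) ]′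
      (conic (γ A x))

    γx∧γy≤ : γ A x ∧ γ A y ≤ γ A (x ∧ y)
    γx∧γy≤ with inverse-comparable (γ-isInverse x) y | inverse-comparable (γ-isInverse y) x
    ... | inj₂ γx≤y | _ =
      trans (x∧y≤x _ _) (γ-mono (∧-greatest refl (trans (x≤γx x) γx≤y)))
    ... | inj₁ _    | inj₂ γy≤x =
      trans (x∧y≤y _ _) (γ-mono (∧-greatest (trans (x≤γx y) γy≤x) refl))
    -- Each element is below the closure of the other, so the closures coincide.
    ... | inj₁ y≤γx | inj₁ x≤γy =
      trans (x∧y≤x _ _) (same-block (antisym (γ-≤ x≤γy) (γ-≤ y≤γx)))

lemma5p4 : ∀ {c ℓ₁ ℓ₂} (A : ResiduatedLattice c ℓ₁ ℓ₂) →
    IsConic A → IsIdempotent A →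
    (IsConjunctive A ⇔ BlocksAreLattices A) ×
    (IsConjunctive A ⇔ PositiveBlocksAreLattices A)
lemma5p4 A conic idem =
    mk⇔ conjunctive⇒blocks (positive-blocks⇒conjunctive ∘ restrict)
  , mk⇔ (restrict ∘ conjunctive⇒blocks) positive-blocks⇒conjunctive
  where
  open ConicIdempotent A conic idem

  restrict : BlocksAreLattices A → PositiveBlocksAreLattices A
  restrict blocks a inv _ = blocks a inv
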